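{- For every positive integer $b$, as $n\to\infty$, \[ \chi\bigl( G_b(n)\bigr)\le \bigl( 2^{(b-1)^2}+o(1)\bigr)\log_{(b-1)}(n)\,. \]
   Context: For positive integers $b,n$, let $V_b(n)$ be the set of tuples $(x_1,\dots,x_{2b-1})$ of integers with $1\le x_1\le x_2\le\dots\le x_{2b-1}\le n$ and $x_1<x_3<\dots<x_{2b-1}$. $G_b(n)$ is the graph on $V_b(n)$ in which $\{\mathbf{x},\mathbf{y}\}$ is an edge iff one can write $\mathbf{x}=(x_1,\dots,x_{2b-1})$, $\mathbf{y}=(y_1,\dots,y_{2b-1})$ (in some order of the two vertices) with (i) $x_1<y_1\le x_3<y_3\le\dots\le x_{2b-1}<y_{2b-1}$ and (ii) $x_{j+1}\le y_j$ for all $j\in[2b-2]$. $\log_{(t)}$ is the $t$-fold iterated base-$2$ logarithm, with $\log_{(0)}(n)=n$. -}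

module Defs where

open import Data.Nat using (ℕ; zero; suc; _+_; _*_; _∸_; _^_; _≤_; _<_)
open import Data.Nat.DivMod using (_/_)
open import Data.Nat.Logarithm using (⌊log₂_⌋)
open import Data.Vec using (Vec; []; _∷_)
open import Data.Fin using (Fin)
open import Data.Product using (Σ; ∃; _×_; proj₁)
open import Data.Sum using (_⊎_)
open import Relation.Binary.PropositionalEquality using (_≢_)

-- 1-based access to a tuple (x₁,…,x_m); value 0 outside the range 1..m
-- (never used outside the range in the definitions below).
get : ∀ {m} → Vec ℕ m → ℕ → ℕ
get []       _             = 0
get (x ∷ xs) zero          = 0
get (x ∷ xs) (suc zero)    = x
get (x ∷ xs) (suc (suc i)) = get xs (suc i)

len : ℕ → ℕ
len b = 2 * b ∸ 1

IsVertex : (b n : ℕ) → Vec ℕ (len b) → Set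
IsVertex b n x =
    (1 ≤ get x 1)
  × (∀ j → 1 ≤ j → j < len b → get x j ≤ get x (suc j))
  × (get x (len b) ≤ n)
  × (∀ k → suc k < b → get x (2 * k + 1) < get x (2 * k + 3))

V : (b n : ℕ) → Set
V b n = Σ (Vec ℕ (len b)) (IsVertex b n)

EdgeDir : (b : ℕ) → Vec ℕ (len b) → Vec ℕ (len b) → Set
EdgeDir b x y =
    (∀ k → k < b → get x (2 * k + 1) < get y (2 * k + 1))
  × (∀ k → suc k < b → get y (2 * k + 1) ≤ get x (2 * k + 3))
  × (∀ j → 1 ≤ j → j ≤ len b ∸ 1 → get x (suc j) ≤ get y j)

Adj : (b : ℕ) → Vec ℕ (len b) → Vec ℕ (len b) → Set
Adj b x y = EdgeDir b x y ⊎ EdgeDir b y x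

ChiLe : (b n K : ℕ) → Set
ChiLe b n K =
  Σ (V b n → Fin K) λ c →
    ∀ (u v : V b n) → Adj b (proj₁ u) (proj₁ v) → c u ≢ c v

logIter : ℕ → ℕ → ℕ
logIter zero    n = n
logIter (suc t) n = ⌊log₂ (logIter t n) ⌋

-- the bound ⌊ (2^{(b-1)^2} + 1/(k+1)) · ⌊log_{(b-1)} n⌋ ⌋
bound : (b k n : ℕ) → ℕ
bound b k n =
  ((suc k * 2 ^ ((b ∸ 1) * (b ∸ 1)) + 1) * logIter (b ∸ 1) n) / suc k

{-# OPTIONS --safe #-}
module Submission where

-- Let δ(x, y) be the position of the highest binary digit in which x and y differ. For x ≤ y ≤ z one has
-- δ(x, z) = max(δ(x, y), δ(y, z)), and δ(x, y) ≠ δ(y, z) unless x = y = z. Look at the gaps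
-- d_i = δ(x_{2i-1}, x_{2i+1}) of a vertex x of G_b(n).
-- If they increase, the numbers z_j = δ(x₁, x_{j+2}) form a vertex of G_{b-1}(⌊log₂ n⌋ + 1), and edges go to
-- edges as soon as both ends agree on b - 1 bits recording coincidences z_j = z_{j+1}. If they decrease, the
-- same holds after reversal. If they have a local extremum, the relative order of all the δ(x_i, x_j),
-- a bounded amount of information, already properly colours these vertices. With C colours for the last case,
-- χ(G_b(n)) ≤ 2^b χ(G_{b-1}(⌊log₂ n⌋ + 1)) + C for b ≥ 3, and one bit suffices for b = 2, so the factor
-- 2^{2b-3} is always enough; these factors multiply up to 2^{(b-1)²}.

open import Defs
open import Data.Empty using (⊥; ⊥-elim)
open import Data.Fin using (Fin; zero; suc; combine; fromℕ<; inject≤)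
open import Data.Fin.Properties using (combine-injective; +↔⊎; *↔×; fromℕ<-injective; inject≤-injective)
open import Data.Nat
open import Data.Nat.DivMod using (/-monoˡ-≤; m*n/n≡m)
open import Data.Nat.Logarithm
open import Data.Nat.Properties
open import Data.Nat.Solver using (module +-*-Solver)
open import Data.Product using (∃; Σ; _×_; _,_)
open import Data.Product.Properties using (,-injective)
open import Data.Sum using (_⊎_; inj₁; inj₂; [_,_]′)
open import Data.Sum.Function.Propositional using (_⊎-↔_)
open import Data.Sum.Properties using (inj₁-injective; inj₂-injective)
open import Data.Vec using (Vec; []; _∷_)
open import Function using (_∘_; _⇔_; mk⇔; mk↣; _↣_; module Equivalence; module Injection)
open import Function.Properties.Inverse using (↔-sym; ↔-trans; ↔⇒↣; ↔-refl)
open import Relation.Binary using (tri<; tri≈; tri>)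
open import Relation.Binary.PropositionalEquality
open import Relation.Nullary using (Dec; yes; no; ¬_; contradiction)
open import Relation.Nullary.Decidable using (True; toWitness)

-- Levels of difference, chains and links.

-- Keeping only these laws makes every result applicable to the `opposite` order. For binary digits
-- `δ-split` holds because a digit cannot rise from 0 to 1 twice in a row.
record Hierarchy : Set₁ where
  infix 4 _≼_
  field
    _≼_     : ℕ → ℕ → Set
    ≼-refl  : ∀ {x} → x ≼ x
    ≼-trans : ∀ {x y z} → x ≼ y → y ≼ z → x ≼ z
    δ       : ℕ → ℕ → ℕ
    δ-max   : ∀ {x y z} → x ≼ y → y ≼ z → δ x z ≡ δ x y ⊔ δ y z
    δ-split : ∀ {x y z} → x ≼ y → y ≼ z → δ x y ≡ δ y z → δ x y ≡ 0

  δ-nest : ∀ {w x y z} → w ≼ x → x ≼ y → y ≼ z → δ x y ≤ δ w z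
  δ-nest {w} {x} {y} {z} wx xy yz = begin
    δ x y          ≤⟨ m≤m⊔n _ _ ⟩
    δ x y ⊔ δ y z  ≡⟨ δ-max xy yz ⟨
    δ x z          ≤⟨ m≤n⊔m _ _ ⟩
    δ w x ⊔ δ x z  ≡⟨ δ-max wx (≼-trans xy yz) ⟨
    δ w z          ∎
    where open ≤-Reasoning

  δ-join : ∀ {x y z m} → x ≼ y → y ≼ z → δ x y ≤ m → δ y z ≤ m → δ x z ≤ m
  δ-join {m = m} xy yz p q = subst (_≤ m) (sym (δ-max xy yz)) (⊔-lub p q)

  δ-right : ∀ {x y z m} → x ≼ y → y ≼ z → δ x y < m → m ≤ δ x z → m ≤ δ y z
  -- Some level lies below `m`, so `m` is a successor and strict bounds become weak ones that
  -- `δ-join` can combine.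
  δ-right {m = suc m} xy yz (s≤s p) q =
    ≮⇒≥ λ { (s≤s r) → <⇒≱ q (δ-join xy yz p r) }

  δ-left : ∀ {x y z m} → x ≼ y → y ≼ z → δ y z < m → m ≤ δ x z → m ≤ δ x y
  δ-left {m = suc m} xy yz (s≤s p) q =
    ≮⇒≥ λ { (s≤s r) → <⇒≱ q (δ-join xy yz r p) }

-- Here `c` is b - 1. Indices start at 0, so the entries x₁, x₃, ... stand at even positions;
-- positive levels encode that they increase strictly.
record Chain (T : Hierarchy) (c : ℕ) (X : ℕ → ℕ) : Set where
  open Hierarchy T
  field
    mono : ∀ j → j < c * 2 → X j ≼ X (suc j)
    sep  : ∀ k → k < c → 0 < δ (X (k * 2)) (X (2 + k * 2))

  mono-≤ : ∀ {i j} → i ≤ j → j ≤ c * 2 → X i ≼ X j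
  mono-≤ {i} {j} i≤j j≤ with m≤n⇒m<n∨m≡n i≤j
  ... | inj₂ refl = ≼-refl
  mono-≤ {i} {suc j} i≤j j≤ | inj₁ (s≤s i≤j′) =
    ≼-trans (mono-≤ i≤j′ (<⇒≤ j≤)) (mono j j≤)

  step : ∀ k → k < c → X (k * 2) ≼ X (2 + k * 2)
  step k k<c = mono-≤ (m≤n+m _ 2) (*-monoˡ-≤ 2 k<c)

record Link (T : Hierarchy) (c : ℕ) (X Y : ℕ → ℕ) : Set where
  open Hierarchy T
  field
    adv  : ∀ j → j < c * 2 → X (suc j) ≼ Y j
    back : ∀ k → k < c → Y (k * 2) ≼ X (2 + k * 2)

-- Reversal: x₁ ≤ … ≤ x_{2b-1} read backwards in the opposite order, which swaps the two ends of a link.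
module _ (T : Hierarchy) where
  open Hierarchy T

  opposite : Hierarchy
  opposite = record
    { _≼_     = λ x y → y ≼ x
    ; ≼-refl  = ≼-refl
    ; ≼-trans = λ p q → ≼-trans q p
    ; δ       = λ x y → δ y x
    ; δ-max   = λ {x} {y} {z} p q → trans (δ-max q p) (⊔-comm (δ z y) (δ y x))
    ; δ-split = λ p q e → trans e (δ-split q p (sym e))
    }

suc-∸-suc : ∀ {m n} → m < n → suc (n ∸ suc m) ≡ n ∸ m
suc-∸-suc m<n = sym (+-∸-assoc 1 m<n)

reverse : ℕ → (ℕ → ℕ) → ℕ → ℕ
reverse m X j = X (m ∸ j)

n*2∸k*2 : ∀ n k → n * 2 ∸ k * 2 ≡ (n ∸ k) * 2
n*2∸k*2 n k = sym (*-distribʳ-∸ 2 n k)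

2+n*2∸ : ∀ n k → k < n → n * 2 ∸ k * 2 ≡ 2 + (n ∸ suc k) * 2
2+n*2∸ n k k<n = trans (n*2∸k*2 n k) (cong (_* 2) (sym (suc-∸-suc k<n)))

reverse-chain : ∀ {T c X} → Chain T c X → Chain (opposite T) c (reverse (c * 2) X)
reverse-chain {T} {c} {X} C = record
  { mono = λ j j< → subst (λ i → X (c * 2 ∸ suc j) ≼ X i) (suc-∸-suc j<)
                      (mono _ (≤-trans (≤-reflexive (suc-∸-suc j<)) (m∸n≤m _ j)))
  ; sep  = λ k k<c → subst₂ (λ i j → 0 < δ (X i) (X j))
                       (sym (n*2∸k*2 c (suc k))) (sym (2+n*2∸ c k k<c))
                       (sep (c ∸ suc k) (≤-trans (≤-reflexive (suc-∸-suc k<c)) (m∸n≤m _ k)))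
  }
  where open Hierarchy T; open Chain C

reverse-link : ∀ {T c X Y} → Link T c X Y →
               Link (opposite T) c (reverse (c * 2) Y) (reverse (c * 2) X)
reverse-link {T} {c} {X} {Y} E = record
  { adv  = λ j j< → subst (λ i → X i ≼ Y (c * 2 ∸ suc j)) (suc-∸-suc j<)
                      (adv _ (≤-trans (≤-reflexive (suc-∸-suc j<)) (m∸n≤m _ j)))
  ; back = λ k k<c → subst₂ (λ i j → Y i ≼ X j)
                       (sym (n*2∸k*2 c (suc k))) (sym (2+n*2∸ c k k<c))
                       (back (c ∸ suc k) (≤-trans (≤-reflexive (suc-∸-suc k<c)) (m∸n≤m _ k)))
  }
  where open Hierarchy T; open Link E

-- Local extrema of the gaps in a window of seven entries.

≤-by : ∀ {m n} → {True (m ≤? n)} → m ≤ n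
≤-by {_} {_} {t} = toWitness t

-- One half of having the same relative order of levels. Both inclusions together transfer strict
-- comparisons too, see `<-transfer`.
Pattern⊆ : Hierarchy → ℕ → (X Y : ℕ → ℕ) → Set
Pattern⊆ T m X Y = ∀ i j k l → i ≤ m → j ≤ m → k ≤ m → l ≤ m →
  δ (X i) (X j) ≤ δ (X k) (X l) → δ (Y i) (Y j) ≤ δ (Y k) (Y l)
  where open Hierarchy T

Pattern⊆-reverse : ∀ {T m X Y} → Pattern⊆ T m X Y →
                   Pattern⊆ (opposite T) m (reverse m X) (reverse m Y)
Pattern⊆-reverse {m = m} P i j k l _ _ _ _ =
  P (m ∸ j) (m ∸ i) (m ∸ l) (m ∸ k) (m∸n≤m m j) (m∸n≤m m i) (m∸n≤m m l) (m∸n≤m m k)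

module Window {T : Hierarchy} {X Y : ℕ → ℕ}
  (CX : Chain T 3 X) (CY : Chain T 3 Y) (E : Link T 3 X Y)
  (P : Pattern⊆ T 6 X Y) (Q : Pattern⊆ T 6 Y X) where

  open Hierarchy T
  open Chain
  open Link E

  -- At concrete indices the implicit `True` arguments are solved by evaluation, so no bound has to
  -- be written.
  x≼x : ∀ i j → {True (i ≤? j)} → {True (j ≤? 6)} → X i ≼ X j
  x≼x i j {p} {q} = mono-≤ CX (toWitness p) (toWitness q)

  y≼y : ∀ i j → {True (i ≤? j)} → {True (j ≤? 6)} → Y i ≼ Y j
  y≼y i j {p} {q} = mono-≤ CY (toWitness p) (toWitness q)

  x≼y : ∀ j → {True (suc j ≤? 6)} → X (suc j) ≼ Y j
  x≼y j {p} = adv j (toWitness p)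

  y≼x : ∀ k → {True (suc k ≤? 3)} → Y (k * 2) ≼ X (2 + k * 2)
  y≼x k {p} = back k (toWitness p)

  ≤-transfer : ∀ i j k l → {True (i ≤? 6)} → {True (j ≤? 6)} → {True (k ≤? 6)} → {True (l ≤? 6)} →
    δ (X i) (X j) ≤ δ (X k) (X l) → δ (Y i) (Y j) ≤ δ (Y k) (Y l)
  ≤-transfer i j k l {p} {q} {r} {s} =
    P i j k l (toWitness p) (toWitness q) (toWitness r) (toWitness s)

  ≤-transfer⁻ : ∀ i j k l → {True (i ≤? 6)} → {True (j ≤? 6)} → {True (k ≤? 6)} → {True (l ≤? 6)} →
    δ (Y i) (Y j) ≤ δ (Y k) (Y l) → δ (X i) (X j) ≤ δ (X k) (X l)
  ≤-transfer⁻ i j k l {p} {q} {r} {s} =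
    Q i j k l (toWitness p) (toWitness q) (toWitness r) (toWitness s)

  <-transfer : ∀ i j k l → {True (i ≤? 6)} → {True (j ≤? 6)} → {True (k ≤? 6)} → {True (l ≤? 6)} →
    δ (X i) (X j) < δ (X k) (X l) → δ (Y i) (Y j) < δ (Y k) (Y l)
  <-transfer i j k l {p} {q} {r} {s} lt =
    ≰⇒> λ le → <⇒≱ lt (≤-transfer⁻ k l i j {r} {s} {p} {q} le)

  -- A link makes both ends attain the peak in the same dyadic block, but only Y 3 lies in its upper half.
  no-peak : δ (X 0) (X 2) < δ (X 2) (X 4) → δ (X 4) (X 6) < δ (X 2) (X 4) → ⊥
  no-peak d₀<d₁ d₂<d₁ = <⇒≱ f₀<f₁ (≤-trans f₁≤d₁ d₁≤f₀)
    where
    open ≤-Reasoning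
    f₀<f₁ : δ (Y 0) (Y 2) < δ (Y 2) (Y 4)
    f₀<f₁ = <-transfer 0 2 2 4 d₀<d₁
    -- `Y 2` and `Y 4` lie between `X 0` and `X 6`, and the peak is the level of that whole stretch.
    f₁≤d₁ : δ (Y 2) (Y 4) ≤ δ (X 2) (X 4)
    f₁≤d₁ = ≤-trans (δ-nest (≼-trans (x≼x 0 3) (x≼y 2)) (y≼y 2 4) (y≼x 2))
      (δ-join (x≼x 0 4) (x≼x 4 6) (δ-join (x≼x 0 2) (x≼x 2 4) (<⇒≤ d₀<d₁) ≤-refl) (<⇒≤ d₂<d₁))
    f₀<d₁ : δ (Y 0) (Y 2) < δ (X 2) (X 4)
    f₀<d₁ = <-≤-trans f₀<f₁ f₁≤d₁
    f₁≤y₂y₃ : δ (Y 2) (Y 4) ≤ δ (Y 2) (Y 3)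
    f₁≤y₂y₃ = begin
      δ (Y 2) (Y 4) ≤⟨ f₁≤d₁ ⟩
      δ (X 2) (X 4) ≤⟨ δ-right (y≼y 0 2) (y≼x 1) f₀<d₁ (δ-nest (y≼x 0) (x≼x 2 4) ≼-refl) ⟩
      δ (Y 2) (X 4) ≤⟨ δ-nest ≼-refl (y≼x 1) (x≼y 3) ⟩
      δ (Y 2) (Y 3) ∎
    -- The pattern carries the peak back from `Y 2`, `Y 3` to `X 2`, `X 3`. These two lie between
    -- `Y 0` and `Y 2`, where all levels stay below the peak.
    d₁≤x₂x₃ : δ (X 2) (X 4) ≤ δ (X 2) (X 3)
    d₁≤x₂x₃ = ≤-transfer⁻ 2 4 2 3 f₁≤y₂y₃
    d₁≤f₀ : δ (X 2) (X 4) ≤ δ (Y 0) (Y 2)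
    d₁≤f₀ = ≤-trans d₁≤x₂x₃ (δ-nest (y≼x 0) (x≼x 2 3) (x≼y 2))

  -- A link forces different outcomes at its two ends when δ (X 2) (X 5) and δ (X 1) (X 4) are compared
  -- with the bottom δ (X 2) (X 4) of the valley.
  no-skew-valley : δ (X 2) (X 4) < δ (X 0) (X 2) → δ (X 0) (X 2) < δ (X 4) (X 6) → ⊥
  no-skew-valley d₁<d₀ d₀<d₂ = <⇒≱ f₁<f₀ (≤-trans f₀≤d₁ (<⇒≤ d₁<f₁))
    where
    open ≤-Reasoning
    f₁<f₀ : δ (Y 2) (Y 4) < δ (Y 0) (Y 2)
    f₁<f₀ = <-transfer 2 4 0 2 d₁<d₀
    -- The last gap of `X` lies between `Y 2` and `Y 5`, while `f₁<f₀` and the valley of `X` keep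
    -- `δ (Y 2) (Y 4)` below that gap.
    y₂y₅≰f₁ : ¬ δ (Y 2) (Y 5) ≤ δ (Y 2) (Y 4)
    y₂y₅≰f₁ le = <-irrefl refl (begin-strict
      δ (X 4) (X 6) ≤⟨ δ-nest (y≼x 1) (x≼x 4 6) (x≼y 5) ⟩
      δ (Y 2) (Y 5) ≤⟨ le ⟩
      δ (Y 2) (Y 4) <⟨ f₁<f₀ ⟩
      δ (Y 0) (Y 2) ≤⟨ δ-nest (≼-trans (x≼x 0 1) (x≼y 0)) (y≼y 0 2) (y≼x 1) ⟩
      δ (X 0) (X 4) ≤⟨ δ-join (x≼x 0 2) (x≼x 2 4) ≤-refl (<⇒≤ d₁<d₀) ⟩
      δ (X 0) (X 2) <⟨ d₀<d₂ ⟩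
      δ (X 4) (X 6) ∎)
    d₁<x₂x₅ : δ (X 2) (X 4) < δ (X 2) (X 5)
    d₁<x₂x₅ = ≰⇒> λ le → y₂y₅≰f₁ (≤-transfer 2 5 2 4 le)
    d₁<x₄x₅ : δ (X 2) (X 4) < δ (X 4) (X 5)
    d₁<x₄x₅ = <-≤-trans d₁<x₂x₅ (δ-right (x≼x 2 4) (x≼x 4 5) d₁<x₂x₅ ≤-refl)
    d₁<f₁ : δ (X 2) (X 4) < δ (Y 2) (Y 4)
    d₁<f₁ = <-≤-trans d₁<x₄x₅ (δ-nest (y≼x 1) (x≼x 4 5) (x≼y 4))
    -- `Y 1` comes after `X 2`, and the stretch from `X 2` to `Y 4` splits at `X 4`, which comes
    -- after `Y 2`.
    y₁y₄≤f₁ : δ (Y 1) (Y 4) ≤ δ (Y 2) (Y 4)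
    y₁y₄≤f₁ = ≤-trans (δ-nest (x≼y 1) (y≼y 1 4) ≼-refl)
      (δ-join (x≼x 2 4) (≼-trans (x≼x 4 5) (x≼y 4)) (<⇒≤ d₁<f₁)
        (δ-nest (y≼x 1) (≼-trans (x≼x 4 5) (x≼y 4)) ≼-refl))
    f₀≤d₁ : δ (Y 0) (Y 2) ≤ δ (X 2) (X 4)
    f₀≤d₁ = ≤-trans (δ-nest (x≼y 0) (y≼y 0 2) (y≼x 1)) (≤-transfer⁻ 1 4 2 4 y₁y₄≤f₁)

no-valley : ∀ {T X Y} → Chain T 3 X → Chain T 3 Y → Link T 3 X Y →
  Pattern⊆ T 6 X Y → Pattern⊆ T 6 Y X → let open Hierarchy T in
  δ (X 2) (X 4) < δ (X 0) (X 2) → δ (X 2) (X 4) < δ (X 4) (X 6) → ⊥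
no-valley {T} {X} {Y} CX CY E P Q d₁<d₀ d₁<d₂ with <-cmp (δ (X 0) (X 2)) (δ (X 4) (X 6))
  where open Hierarchy T
... | tri< d₀<d₂ _ _ = Window.no-skew-valley CX CY E P Q d₁<d₀ d₀<d₂
-- Reversal exchanges the two ends, so the inequalities between the gaps are needed for `Y` and come
-- from `<-transfer`.
... | tri> _ _ d₂<d₀ =
  Window.no-skew-valley (reverse-chain CY) (reverse-chain CX) (reverse-link E)
    (Pattern⊆-reverse {T} {6} {Y} {X} Q) (Pattern⊆-reverse {T} {6} {X} {Y} P)
    (<-transfer 2 4 4 6 d₁<d₂) (<-transfer 4 6 0 2 d₂<d₀)
  where
  open Window CX CY E P Q
-- With equal outer gaps the steps from `X 0` to `X 2` and from `X 2` to `X 6` would have the same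
-- positive level, against `δ-split`.
... | tri≈ _ d₀≡d₂ _ = <-irrefl (sym (δ-split (step 0 ≤-by) (mono-≤ ≤-by ≤-by) d₀≡x₂x₆)) (sep 0 ≤-by)
  where
  open Hierarchy T
  open Chain CX
  d₀≡x₂x₆ : δ (X 0) (X 2) ≡ δ (X 2) (X 6)
  d₀≡x₂x₆ = ≤-antisym
    (≤-trans (≤-reflexive d₀≡d₂) (δ-nest (step 1 ≤-by) (step 2 ≤-by) ≼-refl))
    (δ-join (step 1 ≤-by) (step 2 ≤-by) (<⇒≤ d₁<d₀) (≤-reflexive (sym d₀≡d₂)))

-- Vertices, edges and the shape of the gap sequence.

record Vertex (c n : ℕ) (X : ℕ → ℕ) : Set where
  field
    lower  : 1 ≤ X 0
    weak   : ∀ j → j < c * 2 → X j ≤ X (suc j)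
    upper  : X (c * 2) ≤ n
    strict : ∀ k → k < c → X (k * 2) < X (2 + k * 2)

record Edge (c : ℕ) (X Y : ℕ → ℕ) : Set where
  field
    lt   : ∀ k → k ≤ c → X (k * 2) < Y (k * 2)
    back : ∀ k → k < c → Y (k * 2) ≤ X (2 + k * 2)
    adv  : ∀ j → j < c * 2 → X (suc j) ≤ Y j

module _ (T : Hierarchy) where
  open Hierarchy T

  height : (ℕ → ℕ) → ℕ → ℕ
  height X j = δ (X 0) (X j)

  project : (ℕ → ℕ) → ℕ → ℕ
  project X j = height X (2 + j)

  gap : (ℕ → ℕ) → ℕ → ℕ
  gap X k = δ (X (k * 2)) (X (2 + k * 2))

  Climbs : ℕ → (ℕ → ℕ) → Set
  Climbs c X = ∀ k → k < c → project X (k * 2) < project X (2 + k * 2)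

  GapsIncrease : ℕ → (ℕ → ℕ) → Set
  GapsIncrease m X = ∀ k → k < m → gap X k < gap X (suc k)

  GapsDecrease : ℕ → (ℕ → ℕ) → Set
  GapsDecrease m X = ∀ k → k < m → gap X (suc k) < gap X k

  Peak Valley : (ℕ → ℕ) → ℕ → Set
  Peak   X k = gap X k < gap X (suc k) × gap X (2 + k) < gap X (suc k)
  Valley X k = gap X (suc k) < gap X k × gap X (suc k) < gap X (2 + k)

  Turns : ℕ → (ℕ → ℕ) → Set
  Turns m X = ∃ λ k → suc k < m × (Peak X k ⊎ Valley X k)

extend-< : ∀ {P : ℕ → Set} {m} → (∀ k → k < m → P k) → P m → ∀ k → k < suc m → P k
extend-< f p k (s≤s k≤m) with m≤n⇒m<n∨m≡n k≤m
... | inj₁ k<m  = f k k<m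
... | inj₂ refl = p

module _ {T : Hierarchy} {c : ℕ} {X : ℕ → ℕ} (C : Chain T c X) where
  open Hierarchy T
  open Chain C

  height-mono : ∀ {i j} → i ≤ j → j ≤ c * 2 → height T X i ≤ height T X j
  height-mono i≤j j≤ = δ-nest ≼-refl (mono-≤ z≤n (≤-trans i≤j j≤)) (mono-≤ i≤j j≤)

  -- By `δ-split` two equal consecutive gaps would be 0, against `sep`.
  gap-trichotomy : ∀ k → suc k < c → gap T X k < gap T X (suc k) ⊎ gap T X (suc k) < gap T X k
  gap-trichotomy k k<c with <-cmp (gap T X k) (gap T X (suc k))
  ... | tri< lt _ _ = inj₁ lt
  ... | tri> _ _ gt = inj₂ gt
  ... | tri≈ _ eq _ = contradiction
    (sym (δ-split (step k (<-trans (n<1+n k) k<c)) (step (suc k) k<c) eq))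
    (<⇒≢ (sep k (<-trans (n<1+n k) k<c)))

  gap-shape : ∀ m → m < c → GapsIncrease T m X ⊎ GapsDecrease T m X ⊎ Turns T m X
  gap-shape zero _ = inj₁ λ _ ()
  -- A single gap has no direction, so the first two gaps set it; from then on the first change of
  -- direction is an extremum.
  gap-shape (suc zero) 1<c with gap-trichotomy 0 1<c
  ... | inj₁ lt = inj₁ λ { zero _ → lt ; (suc _) (s≤s ()) }
  ... | inj₂ gt = inj₂ (inj₁ λ { zero _ → gt ; (suc _) (s≤s ()) })
  gap-shape (suc (suc m)) m<c with gap-shape (suc m) (<-trans (n<1+n _) m<c) | gap-trichotomy (suc m) m<c
  ... | inj₁ inc                | inj₁ lt = inj₁ (extend-< inc lt)
  ... | inj₁ inc                | inj₂ gt = inj₂ (inj₂ (m , n<1+n _ , inj₁ (inc m (n<1+n m) , gt)))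
  ... | inj₂ (inj₁ dec)         | inj₁ lt = inj₂ (inj₂ (m , n<1+n _ , inj₂ (dec m (n<1+n m) , lt)))
  ... | inj₂ (inj₁ dec)         | inj₂ gt = inj₂ (inj₁ (extend-< dec gt))
  ... | inj₂ (inj₂ (k , lt , t)) | _      = inj₂ (inj₂ (k , m≤n⇒m≤1+n lt , t))

-- While the gaps increase, the latest one is the maximum, hence equal to the height reached after
-- it.
gaps-increase⇒climbs : ∀ {T c X} → Chain T (suc c) X → GapsIncrease T c X → Climbs T c X
gaps-increase⇒climbs {T} {c} {X} C inc k k<c = begin-strict
  project T X (k * 2)       ≤⟨ height≤gap k (m≤n⇒m≤1+n k<c) ⟩
  gap T X k                 <⟨ inc k k<c ⟩
  gap T X (suc k)           ≤⟨ δ-nest (mono-≤ z≤n (m≤n⇒m≤1+n (m≤n⇒m≤1+n (*-monoˡ-≤ 2 k<c)))) (step (suc k) (s≤s k<c)) ≼-refl ⟩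
  project T X (2 + k * 2)   ∎
  where
  open Hierarchy T
  open Chain C
  open ≤-Reasoning
  height≤gap : ∀ k → k < suc c → project T X (k * 2) ≤ gap T X k
  height≤gap zero    _         = ≤-refl
  height≤gap (suc k) (s≤s k<c) =
    δ-join (mono-≤ z≤n (*-monoˡ-≤ 2 (≤-trans k<c (n≤1+n c)))) (step (suc k) (s≤s k<c))
      (≤-trans (height≤gap k (m≤n⇒m≤1+n k<c)) (<⇒≤ (inc k k<c))) ≤-refl

reverse-gaps-increase : ∀ {T c X} → GapsDecrease T c X →
                        GapsIncrease (opposite T) c (reverse (suc c * 2) X)
reverse-gaps-increase {T} {c} {X} dec k k<c =
  subst₂ _<_ (sym (gap-reverse k (m≤n⇒m≤1+n k<c))) (sym (gap-reverse (suc k) (s≤s k<c)))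
    (subst (λ i → gap T X i < gap T X (c ∸ suc k)) (suc-∸-suc k<c)
      (dec (c ∸ suc k) (≤-trans (≤-reflexive (suc-∸-suc k<c)) (m∸n≤m c k))))
  where
  open Hierarchy T
  gap-reverse : ∀ k → k < suc c → gap (opposite T) (reverse (suc c * 2) X) k ≡ gap T X (c ∸ k)
  gap-reverse k k<c = cong₂ (λ i j → δ (X i) (X j)) (n*2∸k*2 (suc c) (suc k)) (2+n*2∸ (suc c) k k<c)

-- Edges between projected tuples.

-- Bit 0 tells whether z₁ = z₂ and bit k + 1 whether z_{2k+2} = z_{2k+3}, where z is the projected tuple.
Marked : Hierarchy → (ℕ → ℕ) → ℕ → Set
Marked T X zero    = height T X 2 ≡ height T X 3
Marked T X (suc k) = height T X (3 + k * 2) ≡ height T X (4 + k * 2)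

-- By `pull`, a height of `X` above `a 2` is at most the height of `Y` one index earlier. What this
-- leaves open arises only where neighbouring heights coincide, and the marks make these
-- coincidences occur at both ends together.
project-edge : ∀ {T c X Y} → Chain T (2 + c) X → Chain T (2 + c) Y → Link T (2 + c) X Y →
  Climbs T (suc c) X → Climbs T (suc c) Y →
  (∀ k → k < 2 + c → Marked T X k ⇔ Marked T Y k) →
  Edge (suc c) (project T X) (project T Y)
project-edge {T} {c} {X} {Y} CX CY E climbX climbY marks = record
  { lt   = project-lt
  ; back = λ k k<c → δ-nest x₀≼y₀ (CY.mono-≤ z≤n (m≤n⇒m≤1+n (m≤n⇒m≤1+n (*-monoˡ-≤ 2 k<c)))) (E.back (suc k) (s≤s k<c))
  ; adv  = project-adv
  }
  where
  open Hierarchy T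
  open ≤-Reasoning
  module CX = Chain CX
  module CY = Chain CY
  module E = Link E

  a e : ℕ → ℕ
  a = height T X
  e = height T Y

  top : ℕ
  top = (2 + c) * 2

  3≤top : 3 ≤ top
  3≤top = s≤s (s≤s (s≤s z≤n))

  4≤top : 4 ≤ top
  4≤top = m≤m+n 4 (c * 2)

  x₀≼y₀ : X 0 ≼ Y 0
  x₀≼y₀ = ≼-trans (CX.mono 0 (s≤s z≤n)) (E.adv 0 (s≤s z≤n))

  e-mono : ∀ {i j} → i ≤ j → j ≤ top → e i ≤ e j
  e-mono = height-mono CY

  a₂<a : ∀ {m} → 4 ≤ m → m ≤ top → a 2 < a m
  a₂<a 4≤m m≤ = <-≤-trans (climbX 0 (s≤s z≤n)) (height-mono CX 4≤m m≤)

  -- Y 0 lies between X 0 and X 2, so a separation of X 0 from Y j above the level a 2 also separates Y 0 from Y j.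
  pull : ∀ j → suc j ≤ top → a 2 < a (suc j) → a (suc j) ≤ e j
  pull j j≤ a₂<aj = δ-right x₀≼y₀ (CY.mono-≤ z≤n (<⇒≤ j≤))
    (≤-<-trans (δ-nest ≼-refl x₀≼y₀ (E.back 0 (s≤s z≤n))) a₂<aj)
    (δ-nest ≼-refl (CX.mono-≤ z≤n j≤) (E.adv j j≤))

  project-adv : ∀ j → j < suc c * 2 → a (3 + j) ≤ e (2 + j)
  project-adv (suc j) j< = pull (3 + j) (s≤s (s≤s j<)) (a₂<a (m≤m+n 4 j) (s≤s (s≤s j<)))
  -- Only here can the height of `X` equal `a 2`, out of reach of `pull`. Then bit 0 gives
  -- `e 2 ≡ e 3`, and `a 4` takes the place of `a 3`.
  project-adv zero _ with a 2 ≟ a 3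
  ... | no a₂≢a₃ = pull 2 3≤top (≤∧≢⇒< (height-mono CX (n≤1+n 2) 3≤top) a₂≢a₃)
  ... | yes a₂≡a₃ = begin
    a 3 ≡⟨ a₂≡a₃ ⟨
    a 2 <⟨ a₂<a ≤-refl 4≤top ⟩
    a 4 ≤⟨ pull 3 4≤top (a₂<a ≤-refl 4≤top) ⟩
    e 3 ≡⟨ Equivalence.to (marks 0 (s≤s z≤n)) a₂≡a₃ ⟨
    e 2 ∎

  project-lt : ∀ k → k ≤ suc c → project T X (k * 2) < project T Y (k * 2)
  project-lt zero _ with a 2 ≟ a 3
  ... | no a₂≢a₃ = <-≤-trans (≤∧≢⇒< (height-mono CX (n≤1+n 2) 3≤top) a₂≢a₃) (project-adv 0 (s≤s z≤n))
  ... | yes a₂≡a₃ = begin-strict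
    a 2 <⟨ a₂<a ≤-refl 4≤top ⟩
    a 4 ≤⟨ pull 3 4≤top (a₂<a ≤-refl 4≤top) ⟩
    e 3 ≡⟨ Equivalence.to (marks 0 (s≤s z≤n)) a₂≡a₃ ⟨
    e 2 ∎
  -- Otherwise `pull` squeezes the last two heights of `Y` together. The mark moves this coincidence
  -- to `X`, and a second `pull`, one index earlier, contradicts the climb of `Y`.
  project-lt (suc k) k≤c = ≰⇒> λ e≤a → <-irrefl refl (begin-strict
    e (4 + k * 2) ≤⟨ e≤a ⟩
    a (4 + k * 2) ≡⟨ a≡ e≤a ⟨
    a (3 + k * 2) ≤⟨ pull (2 + k * 2) 3+k≤top (<-≤-trans a₂<a₄ (≤-reflexive (sym (a≡ e≤a)))) ⟩
    e (2 + k * 2) <⟨ climbY k k≤c ⟩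
    e (4 + k * 2) ∎)
    where
    4+k≤top : 4 + k * 2 ≤ top
    4+k≤top = s≤s (s≤s (*-monoˡ-≤ 2 k≤c))
    3+k≤top : 3 + k * 2 ≤ top
    3+k≤top = <⇒≤ 4+k≤top
    a₂<a₄ : a 2 < a (4 + k * 2)
    a₂<a₄ = a₂<a (m≤m+n 4 (k * 2)) 4+k≤top
    a≡ : e (4 + k * 2) ≤ a (4 + k * 2) → a (3 + k * 2) ≡ a (4 + k * 2)
    a≡ e≤a = Equivalence.from (marks (suc k) (s≤s k≤c)) (≤-antisym (e-mono (n≤1+n _) 4+k≤top)
      (≤-trans e≤a (pull (3 + k * 2) 4+k≤top a₂<a₄)))

-- If both heights were h, then `X 0` and `Y 0` would also differ at level h: when the mark is set,
-- already `X 1` reaches h, and otherwise `Y 0` and `X 2` differ below h. Then `X 0`, `Y 0`, `Y 2`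
-- violate `δ-split`.
project-apart : ∀ {T X Y} → Chain T 1 X → Chain T 1 Y → Link T 1 X Y →
  (height T X 1 ≡ height T X 2 ⇔ height T Y 1 ≡ height T Y 2) →
  height T X 2 ≢ height T Y 2
project-apart {T} {X} {Y} CX CY E mark a≡e = split-twice a₂≤x₀y₀
  where
  open Hierarchy T
  module CX = Chain CX
  module CY = Chain CY
  module E = Link E
  x₀≼y₀ : X 0 ≼ Y 0
  x₀≼y₀ = ≼-trans (CX.mono 0 ≤-by) (E.adv 0 ≤-by)
  y₀≼x₂ : Y 0 ≼ X 2
  y₀≼x₂ = E.back 0 ≤-by
  a₂≤x₀y₀ : height T X 2 ≤ δ (X 0) (Y 0)
  a₂≤x₀y₀ with height T Y 1 ≟ height T Y 2
  ... | yes e₁≡e₂ = ≤-trans (≤-reflexive (sym (Equivalence.from mark e₁≡e₂)))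
    (δ-nest ≼-refl (CX.mono 0 ≤-by) (E.adv 0 ≤-by))
  ... | no  e₁≢e₂ = δ-left x₀≼y₀ y₀≼x₂
    (≤-<-trans (δ-nest ≼-refl y₀≼x₂ (E.adv 1 ≤-by))
      (<-≤-trans (≤∧≢⇒< (height-mono CY ≤-by ≤-by) e₁≢e₂) (≤-reflexive (sym a≡e))))
    ≤-refl
  split-twice : height T X 2 ≤ δ (X 0) (Y 0) → ⊥
  split-twice le = <⇒≢ (CX.sep 0 ≤-by) (sym (n≤0⇒n≡0 (≤-trans le (≤-reflexive
    (δ-split x₀≼y₀ (CY.step 0 ≤-by)
      (trans (≤-antisym (δ-nest ≼-refl x₀≼y₀ y₀≼x₂) le) a≡e))))))

-- The dyadic hierarchy on natural numbers.

-- For x, y < 2^L: one plus the position of the highest binary digit in which x and y differ, or 0 if x = y.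
level : ℕ → ℕ → ℕ → ℕ
level zero    x y = 0
level (suc L) x y with x ≟ y
... | yes _ = 0
... | no  _ = suc (level L ⌊ x /2⌋ ⌊ y /2⌋)

level-≤ : ∀ L x y → level L x y ≤ L
level-≤ zero    x y = z≤n
level-≤ (suc L) x y with x ≟ y
... | yes _ = z≤n
... | no  _ = s≤s (level-≤ L _ _)

level-refl : ∀ L x → level L x x ≡ 0
level-refl zero    x = refl
level-refl (suc L) x with x ≟ x
... | yes _ = refl
... | no ¬p = contradiction refl ¬p

level-max : ∀ L {x y z} → x ≤ y → y ≤ z → level L x z ≡ level L x y ⊔ level L y z
level-max zero x≤y y≤z = refl
level-max (suc L) {x} {y} {z} x≤y y≤z with x ≟ z | x ≟ y | y ≟ z
... | yes _    | yes _    | yes _    = refl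
... | yes refl | no x≢y   | _        = contradiction (≤-antisym x≤y y≤z) x≢y
... | yes refl | yes refl | no y≢z   = contradiction refl y≢z
... | no x≢z   | yes refl | yes refl = contradiction refl x≢z
... | no _     | yes refl | no _     = refl
... | no _     | no _     | yes refl = refl
... | no _     | no _     | no _     = cong suc (level-max L (⌊n/2⌋-mono x≤y) (⌊n/2⌋-mono y≤z))

⌊/2⌋<2^ : ∀ L {x} → x < 2 ^ suc L → ⌊ x /2⌋ < 2 ^ L
⌊/2⌋<2^ L {x} x< = ≰⇒> λ 2^L≤ → <⇒≱ x< (begin
  2 ^ L + (2 ^ L + 0)      ≡⟨ cong (2 ^ L +_) (+-identityʳ _) ⟩
  2 ^ L + 2 ^ L            ≤⟨ +-mono-≤ 2^L≤ (≤-trans 2^L≤ (⌊n/2⌋≤⌈n/2⌉ x)) ⟩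
  ⌊ x /2⌋ + ⌈ x /2⌉        ≡⟨ ⌊n/2⌋+⌈n/2⌉≡n x ⟩
  x                        ∎)
  where open ≤-Reasoning

level-zero : ∀ L {x y} → x ≤ y → y < 2 ^ L → level L x y ≡ 0 → x ≡ y
level-zero zero    z≤n (s≤s z≤n) _ = refl
level-zero (suc L) {x} {y} _ _ eq with x ≟ y
level-zero (suc L) _ _ _  | yes x≡y = x≡y
level-zero (suc L) _ _ () | no _

⌊/2⌋-collision : ∀ {x y z} → x < y → y < z → ⌊ x /2⌋ ≡ ⌊ y /2⌋ → ⌊ y /2⌋ ≡ ⌊ z /2⌋ → ⊥
⌊/2⌋-collision {x} {y} {z} x<y y<z p q = <-irrefl (trans p q) (begin-strict
  ⌊ x /2⌋      <⟨ ≤-refl ⟩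
  ⌊ 2 + x /2⌋  ≤⟨ ⌊n/2⌋-mono (≤-trans (s≤s x<y) y<z) ⟩
  ⌊ z /2⌋      ∎)
  where open ≤-Reasoning

-- Equal levels of distinct neighbours pass to the halves, where they are 0 by induction. So all
-- three halves agree, but no three distinct numbers share a half.
level-split : ∀ L {x y z} → x ≤ y → y ≤ z → z < 2 ^ L → level L x y ≡ level L y z → level L x y ≡ 0
level-split zero    _ _ _ _ = refl
level-split (suc L) {x} {y} {z} x≤y y≤z z< eq with x ≟ y | y ≟ z
... | yes _  | _        = refl
... | no _   | yes refl = eq
... | no x≢y | no y≢z   = ⊥-elim (⌊/2⌋-collision (≤∧≢⇒< x≤y x≢y) (≤∧≢⇒< y≤z y≢z)
    (level-zero L x/2≤y/2 (≤-<-trans y/2≤z/2 z/2<) xy≡0)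
    (level-zero L y/2≤z/2 z/2< (trans (sym (suc-injective eq)) xy≡0)))
  where
  x/2≤y/2 : ⌊ x /2⌋ ≤ ⌊ y /2⌋
  x/2≤y/2 = ⌊n/2⌋-mono x≤y
  y/2≤z/2 : ⌊ y /2⌋ ≤ ⌊ z /2⌋
  y/2≤z/2 = ⌊n/2⌋-mono y≤z
  z/2< : ⌊ z /2⌋ < 2 ^ L
  z/2< = ⌊/2⌋<2^ L z<
  xy≡0 : level L ⌊ x /2⌋ ⌊ y /2⌋ ≡ 0
  xy≡0 = level-split L x/2≤y/2 y/2≤z/2 z/2< (suc-injective eq)

-- The order is restricted to numbers below 2^L, apart from reflexivity: level L separates no others.
dyadic : ℕ → Hierarchy
dyadic L = record
  { _≼_     = λ x y → x ≤ y × (x ≡ y ⊎ y < 2 ^ L)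
  ; ≼-refl  = ≤-refl , inj₁ refl
  ; ≼-trans = λ { (p , inj₁ refl) q → q
                ; (p , inj₂ _) (q , inj₂ z<) → ≤-trans p q , inj₂ z<
                ; (p , inj₂ y<) (q , inj₁ refl) → p , inj₂ y< }
  ; δ       = level L
  ; δ-max   = λ (p , _) (q , _) → level-max L p q
  ; δ-split = λ { (p , _) (q , inj₂ z<) eq → level-split L p q z< eq
                ; (p , _) (q , inj₁ refl) eq → trans eq (level-refl L _) }
  }

module _ {c n L : ℕ} (n< : n < 2 ^ L) where
  open Vertex

  Vertex-mono : ∀ {X} → Vertex c n X → ∀ {i j} → i ≤ j → j ≤ c * 2 → X i ≤ X j
  Vertex-mono V {i} {j} i≤j j≤ with m≤n⇒m<n∨m≡n i≤j
  ... | inj₂ refl = ≤-refl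
  Vertex-mono V {i} {suc j} i≤j j≤ | inj₁ (s≤s i≤j′) =
    ≤-trans (Vertex-mono V i≤j′ (<⇒≤ j≤)) (weak V j j≤)

  Vertex-< : ∀ {X} → Vertex c n X → ∀ {j} → j ≤ c * 2 → X j < 2 ^ L
  Vertex-< V j≤ = ≤-<-trans (≤-trans (Vertex-mono V j≤ ≤-refl) (upper V)) n<

  dyadic-chain : ∀ {X} → Vertex c n X → Chain (dyadic L) c X
  dyadic-chain V = record
    { mono = λ j j< → weak V j j< , inj₂ (Vertex-< V j<)
    ; sep  = λ k k<c → n≢0⇒n>0 λ eq → <⇒≢ (strict V k k<c)
        (level-zero L (<⇒≤ (strict V k k<c)) (Vertex-< V (*-monoˡ-≤ 2 k<c)) eq)
    }

  dyadic-link : ∀ {X Y} → Vertex c n X → Vertex c n Y → Edge c X Y → Link (dyadic L) c X Y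
  dyadic-link VX VY E = record
    { adv  = λ j j< → Edge.adv E j j< , inj₂ (Vertex-< VY (<⇒≤ j<))
    ; back = λ k k<c → Edge.back E k k<c , inj₂ (Vertex-< VX (*-monoˡ-≤ 2 k<c))
    }

project-vertex : ∀ {T c L X} → (∀ x y → Hierarchy.δ T x y ≤ L) → Chain T (suc c) X →
  Climbs T c X → Vertex c L (project T X)
project-vertex bounded C climb = record
  { lower  = Chain.sep C 0 (s≤s z≤n)
  ; weak   = λ j j< → height-mono C (n≤1+n _) (s≤s (s≤s j<))
  ; upper  = bounded _ _
  ; strict = climb
  }

n<2^[1+⌊log₂n⌋] : ∀ n → n < 2 ^ suc ⌊log₂ n ⌋
n<2^[1+⌊log₂n⌋] n = ≰⇒> λ le → <-irrefl refl (begin-strict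
  ⌊log₂ n ⌋                   <⟨ ≤-refl ⟩
  suc ⌊log₂ n ⌋               ≡⟨ ⌊log₂[2^n]⌋≡n (suc ⌊log₂ n ⌋) ⟨
  ⌊log₂ 2 ^ suc ⌊log₂ n ⌋ ⌋   ≤⟨ ⌊log₂⌋-mono-≤ le ⟩
  ⌊log₂ n ⌋                   ∎)
  where open ≤-Reasoning

⌊log₂[1+n]⌋≤1+⌊log₂n⌋ : ∀ n → ⌊log₂ suc n ⌋ ≤ suc ⌊log₂ n ⌋
⌊log₂[1+n]⌋≤1+⌊log₂n⌋ zero      = z≤n
⌊log₂[1+n]⌋≤1+⌊log₂n⌋ n@(suc m) = begin
  ⌊log₂ suc n ⌋     ≤⟨ ⌊log₂⌋-mono-≤ (s≤s (≤-trans (m≤n+m n m) (+-monoʳ-≤ m (m≤m+n n 0)))) ⟩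
  ⌊log₂ (2 * n) ⌋   ≡⟨ ⌊log₂[2*b]⌋≡1+⌊log₂b⌋ n ⟩
  suc ⌊log₂ n ⌋     ∎
  where open ≤-Reasoning

-- Colourings and finite codes.

-- Oriented edges suffice because `≢` is symmetric. The colours may form any type and are counted
-- only later.
Colouring : ℕ → ℕ → Set → Set
Colouring c n P = Σ (∀ X → Vertex c n X → P) λ f →
  ∀ {X Y} (VX : Vertex c n X) (VY : Vertex c n Y) → Edge c X Y → f X VX ≢ f Y VY

recolour : ∀ {c n} {P Q : Set} → P ↣ Q → Colouring c n P → Colouring c n Q
recolour ι (f , proper) =
  (λ X V → Injection.to ι (f X V)) , λ VX VY E eq → proper VX VY E (Injection.injective ι eq)

code : ∀ {a} m → (ℕ → Fin a) → Fin (a ^ m)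
code zero    f = zero
code (suc m) f = combine (f 0) (code m (f ∘ suc))

code-injective : ∀ {a} m {f g : ℕ → Fin a} → code m f ≡ code m g → ∀ i → i < m → f i ≡ g i
code-injective (suc m) {f} {g} eq i i<m
  with combine-injective (f 0) (code m (f ∘ suc)) (g 0) (code m (g ∘ suc)) eq | i | i<m
... | eq₀ , _  | zero  | _       = eq₀
... | _ , eqₛ | suc j | s≤s j<m = code-injective m eqₛ j j<m

bit : ∀ {P : Set} → Dec P → Fin 2
bit (yes _) = suc zero
bit (no  _) = zero

bit-⇔ : ∀ {P Q : Set} (p : Dec P) (q : Dec Q) → bit p ≡ bit q → P ⇔ Q
bit-⇔ (yes p) (yes q) _ = mk⇔ (λ _ → q) (λ _ → p)
bit-⇔ (no ¬p) (no ¬q) _ = mk⇔ (λ p → contradiction p ¬p) (λ q → contradiction q ¬q)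

marked? : ∀ T X k → Dec (Marked T X k)
marked? T X zero    = _ ≟ _
marked? T X (suc k) = _ ≟ _

marks : Hierarchy → (c : ℕ) → (ℕ → ℕ) → Fin (2 ^ c)
marks T c X = code c (λ k → bit (marked? T X k))

marks-⇔ : ∀ T c X Y → marks T c X ≡ marks T c Y → ∀ k → k < c → Marked T X k ⇔ Marked T Y k
marks-⇔ T c X Y eq k k<c = bit-⇔ (marked? T X k) (marked? T Y k) (code-injective c eq k k<c)

-- This is 2^(m⁴), one bit for each comparison of two levels, nested because `code` is applied once
-- for each of the four indices.
#patterns : ℕ → ℕ
#patterns m = (((2 ^ m) ^ m) ^ m) ^ m

module Patterns (T : Hierarchy) (m : ℕ) where
  open Hierarchy T

  compare₄ : (ℕ → ℕ) → ℕ → ℕ → ℕ → ℕ → Fin 2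
  compare₄ X i j k l = bit (δ (X i) (X j) ≤? δ (X k) (X l))

  compare₃ : (ℕ → ℕ) → ℕ → ℕ → ℕ → Fin (2 ^ m)
  compare₃ X i j k = code m (compare₄ X i j k)

  compare₂ : (ℕ → ℕ) → ℕ → ℕ → Fin ((2 ^ m) ^ m)
  compare₂ X i j = code m (compare₃ X i j)

  compare₁ : (ℕ → ℕ) → ℕ → Fin (((2 ^ m) ^ m) ^ m)
  compare₁ X i = code m (compare₂ X i)

  pattern-code : (ℕ → ℕ) → Fin (#patterns m)
  pattern-code X = code m (compare₁ X)

  pattern-code-injective : ∀ X Y → pattern-code X ≡ pattern-code Y →
    ∀ i j k l → i < m → j < m → k < m → l < m →
    δ (X i) (X j) ≤ δ (X k) (X l) → δ (Y i) (Y j) ≤ δ (Y k) (Y l)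
  pattern-code-injective X Y eq i j k l i< j< k< l< = Equivalence.to (bit-⇔ (_ ≤? _) (_ ≤? _) eq₄)
    where
    eq₁ : compare₁ X i ≡ compare₁ Y i
    eq₁ = code-injective m eq i i<
    eq₂ : compare₂ X i j ≡ compare₂ Y i j
    eq₂ = code-injective m eq₁ j j<
    eq₃ : compare₃ X i j k ≡ compare₃ Y i j k
    eq₃ = code-injective m eq₂ k k<
    eq₄ : compare₄ X i j k l ≡ compare₄ Y i j k l
    eq₄ = code-injective m eq₃ l l<

open Patterns using (pattern-code; pattern-code-injective)

pattern-code-⊆ : ∀ T m X Y → pattern-code T (suc m) X ≡ pattern-code T (suc m) Y → Pattern⊆ T m X Y
pattern-code-⊆ T m X Y eq i j k l i≤ j≤ k≤ l≤ =
  pattern-code-injective T (suc m) X Y eq i j k l (s≤s i≤) (s≤s j≤) (s≤s k≤) (s≤s l≤)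

-- With the offset added on the right, `Peak` and `Valley` at `k` reduce to the hypotheses of
-- `no-peak` and `no-valley` for the window.
window : ℕ → (ℕ → ℕ) → ℕ → ℕ
window k X j = X (j + k * 2)

window-≤ : ∀ {c k} j → 3 + k ≤ c → j ≤ 6 → j + k * 2 ≤ c * 2
window-≤ {c} {k} j k≤c j≤6 = ≤-trans (+-monoˡ-≤ (k * 2) j≤6) (*-monoˡ-≤ 2 k≤c)

window-chain : ∀ {T c X k} → 3 + k ≤ c → Chain T c X → Chain T 3 (window k X)
window-chain {T} {X = X} {k} k≤c C = record
  { mono = λ j j< → mono (j + k * 2) (window-≤ (suc j) k≤c j<)
  ; sep  = λ i i<3 → subst (λ o → 0 < δ (X o) (X (2 + o))) (*-distribʳ-+ 2 i k)
      (sep (i + k) (≤-trans (+-monoˡ-≤ k i<3) k≤c))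
  }
  where
  open Hierarchy T
  open Chain C

window-link : ∀ {T c X Y k} → 3 + k ≤ c → Link T c X Y → Link T 3 (window k X) (window k Y)
window-link {T} {X = X} {Y} {k} k≤c E = record
  { adv  = λ j j< → adv (j + k * 2) (window-≤ (suc j) k≤c j<)
  ; back = λ i i<3 → subst (λ o → Y o ≼ X (2 + o)) (*-distribʳ-+ 2 i k)
      (back (i + k) (≤-trans (+-monoˡ-≤ k i<3) k≤c))
  }
  where
  open Hierarchy T
  open Link E

window-pattern : ∀ {T c X Y k} → 3 + k ≤ c → Pattern⊆ T (c * 2) X Y →
  Pattern⊆ T 6 (window k X) (window k Y)
window-pattern k≤c P i j k l i≤ j≤ k≤ l≤ =
  P _ _ _ _ (window-≤ i k≤c i≤) (window-≤ j k≤c j≤) (window-≤ k k≤c k≤) (window-≤ l k≤c l≤)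

no-turn : ∀ {T c X Y} → Chain T (suc c) X → Chain T (suc c) Y → Link T (suc c) X Y →
  pattern-code T (suc (suc c * 2)) X ≡ pattern-code T (suc (suc c * 2)) Y → ¬ Turns T c X
no-turn {T} {c} {X} {Y} CX CY E eq (k , k<c , turn) =
  [ (λ (p , q) → Window.no-peak WX WY F P Q p q) , (λ (p , q) → no-valley WX WY F P Q p q) ]′ turn
  where
  3+k≤ : 3 + k ≤ suc c
  3+k≤ = s≤s k<c
  WX = window-chain {k = k} 3+k≤ CX
  WY = window-chain {k = k} 3+k≤ CY
  F  = window-link {k = k} 3+k≤ E
  P  = window-pattern {T} {X = X} {Y} {k} 3+k≤ (pattern-code-⊆ T (suc c * 2) X Y eq)
  Q  = window-pattern {T} {X = Y} {X} {k} 3+k≤ (pattern-code-⊆ T (suc c * 2) Y X (sym eq))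

-- Lifting a colouring of projected tuples.

-- The summands belong to increasing gaps, decreasing gaps and gaps with a turn.
Palette : ℕ → Set → Set
Palette c P = (Fin (2 ^ c) × P) ⊎ (Fin (2 ^ c) × P) ⊎ Fin (#patterns (suc (c * 2)))

module Colourings {n L : ℕ} (T : Hierarchy)
  (bounded : ∀ x y → Hierarchy.δ T x y ≤ L)
  (chain : ∀ {c X} → Vertex c n X → Chain T c X)
  (link : ∀ {c X Y} → Vertex c n X → Vertex c n Y → Edge c X Y → Link T c X Y) where

  colour-triples : ∀ {P : Set} → Colouring 0 L P → Colouring 1 n (Fin 2 × P)
  colour-triples {P} (f , proper) = g , g-proper
    where
    g : ∀ X → Vertex 1 n X → Fin 2 × P
    g X V = bit (height T X 1 ≟ height T X 2) ,
            f (project T X) (project-vertex bounded (chain V) (λ _ ()))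

    single : ∀ {Z W} → Z 0 < W 0 → Edge 0 Z W
    single Z<W = record { lt = λ { zero _ → Z<W } ; back = λ _ () ; adv = λ _ () }

    g-proper : ∀ {X Y} (VX : Vertex 1 n X) (VY : Vertex 1 n Y) → Edge 1 X Y → g X VX ≢ g Y VY
    g-proper {X} {Y} VX VY E eq with ,-injective eq
    -- Projected triples are single numbers, joined in whichever direction they are ordered; only
    -- equality has to be excluded.
    ... | eq₁ , eq₂ with <-cmp (height T X 2) (height T Y 2)
    ... | tri< lt _ _ = proper _ _ (single lt) eq₂
    ... | tri> _ _ gt = proper _ _ (single gt) (sym eq₂)
    ... | tri≈ _ same _ = project-apart (chain VX) (chain VY)
      (link VX VY E) (bit-⇔ (_ ≟ _) (_ ≟ _) eq₁) same

  colour-tuples : ∀ {c} {P : Set} → Colouring (suc c) L P → Colouring (2 + c) n (Palette (2 + c) P)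
  colour-tuples {c} {P} (f , proper) =
    -- Taking the shape as an argument reduces properness to a split on two shapes, and the tags of
    -- the palette settle the mixed cases.
    (λ X V → g X V (shape V)) , λ VX VY E → g-proper VX VY E (shape VX) (shape VY)
    where
    X° : (ℕ → ℕ) → ℕ → ℕ
    X° = reverse ((2 + c) * 2)

    Shape : (ℕ → ℕ) → Set
    Shape X = GapsIncrease T (suc c) X ⊎ GapsDecrease T (suc c) X ⊎ Turns T (suc c) X

    chain° : ∀ {X} → Vertex (2 + c) n X → Chain (opposite T) (2 + c) (X° X)
    chain° V = reverse-chain (chain V)

    shape : ∀ {X} → Vertex (2 + c) n X → Shape X
    shape V = gap-shape (chain V) (suc c) ≤-refl

    climbs : ∀ {X} → Vertex (2 + c) n X → GapsIncrease T (suc c) X → Climbs T (suc c) X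
    climbs V = gaps-increase⇒climbs (chain V)

    climbs° : ∀ {X} → Vertex (2 + c) n X → GapsDecrease T (suc c) X → Climbs (opposite T) (suc c) (X° X)
    climbs° {X} V dec = gaps-increase⇒climbs (chain° V) (reverse-gaps-increase {T} {suc c} {X} dec)

    g : ∀ X → Vertex (2 + c) n X → Shape X → Palette (2 + c) P
    g X V (inj₁ inc) = inj₁ (marks T (2 + c) X ,
      f (project T X) (project-vertex bounded (chain V) (climbs V inc)))
    g X V (inj₂ (inj₁ dec)) = inj₂ (inj₁ (marks (opposite T) (2 + c) (X° X) ,
      f (project (opposite T) (X° X))
        (project-vertex (λ x y → bounded y x) (chain° V) (climbs° V dec))))
    g X V (inj₂ (inj₂ _)) = inj₂ (inj₂ (pattern-code T (suc ((2 + c) * 2)) X))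

    g-proper : ∀ {X Y} (VX : Vertex (2 + c) n X) (VY : Vertex (2 + c) n Y) → Edge (2 + c) X Y →
      (sX : Shape X) (sY : Shape Y) → g X VX sX ≢ g Y VY sY
    g-proper {X} {Y} VX VY E (inj₁ incX) (inj₁ incY) eq with ,-injective (inj₁-injective eq)
    ... | eq₁ , eq₂ = proper _ _
      (project-edge (chain VX) (chain VY) (link VX VY E) (climbs VX incX) (climbs VY incY)
        (marks-⇔ T (2 + c) X Y eq₁)) eq₂
    g-proper {X} {Y} VX VY E (inj₂ (inj₁ decX)) (inj₂ (inj₁ decY)) eq
      with ,-injective (inj₁-injective (inj₂-injective eq))
    ... | eq₁ , eq₂ = proper _ _
      -- After reversal the edge runs from `Y` to `X`.
      (project-edge (chain° VY) (chain° VX) (reverse-link (link VX VY E))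
        (climbs° VY decY) (climbs° VX decX)
        (marks-⇔ (opposite T) (2 + c) (X° Y) (X° X) (sym eq₁))) (sym eq₂)
    g-proper VX VY E (inj₂ (inj₂ turnX)) (inj₂ (inj₂ _)) eq =
      no-turn (chain VX) (chain VY) (link VX VY E) (inj₂-injective (inj₂-injective eq)) turnX
    g-proper VX VY E (inj₁ _)        (inj₂ (inj₁ _)) ()
    g-proper VX VY E (inj₁ _)        (inj₂ (inj₂ _)) ()
    g-proper VX VY E (inj₂ (inj₁ _)) (inj₁ _)        ()
    g-proper VX VY E (inj₂ (inj₁ _)) (inj₂ (inj₂ _)) ()
    g-proper VX VY E (inj₂ (inj₂ _)) (inj₁ _)        ()
    g-proper VX VY E (inj₂ (inj₂ _)) (inj₂ (inj₁ _)) ()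

-- Translation to the tuples of the theorem.

-- The theorem's tuples are 1-based: x_{2k+1} is entry k * 2 of the 0-based sequence.
entries : ∀ {m} → Vec ℕ m → ℕ → ℕ
entries x j = get x (suc j)

tuple : ∀ m → (ℕ → ℕ) → Vec ℕ m
tuple zero    X = []
tuple (suc m) X = X 0 ∷ tuple m (X ∘ suc)

entries-tuple : ∀ m X {j} → j < m → entries (tuple m X) j ≡ X j
entries-tuple (suc m) X {zero}  _         = refl
entries-tuple (suc m) X {suc j} (s≤s j<m) = entries-tuple m (X ∘ suc) j<m

len≡ : ∀ c → len (suc c) ≡ suc (c * 2)
len≡ c = trans (+-suc c (c + 0)) (cong suc (*-comm 2 c))

2k+1≡ : ∀ k → 2 * k + 1 ≡ suc (k * 2)
2k+1≡ k = trans (+-comm (2 * k) 1) (cong suc (*-comm 2 k))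

2k+3≡ : ∀ k → 2 * k + 3 ≡ suc (2 + k * 2)
2k+3≡ k = trans (+-comm (2 * k) 3) (cong (3 +_) (*-comm 2 k))

module _ {c : ℕ} where

  module _ (n : ℕ) (x : Vec ℕ (len (suc c))) where

    IsVertex⇒Vertex : IsVertex (suc c) n x → Vertex c n (entries x)
    IsVertex⇒Vertex (lower , weak , upper , strict) = record
      { lower  = lower
      ; weak   = λ j j< → weak (suc j) (s≤s z≤n) (≤-trans (s≤s j<) (≤-reflexive (sym (len≡ c))))
      ; upper  = subst (λ i → get x i ≤ n) (len≡ c) upper
      ; strict = λ k k<c → subst₂ (λ i j → get x i < get x j) (2k+1≡ k) (2k+3≡ k) (strict k (s≤s k<c))
      }

    Vertex⇒IsVertex : Vertex c n (entries x) → IsVertex (suc c) n x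
    Vertex⇒IsVertex V =
        lower
      , (λ { (suc j) _ j< → weak j (s≤s⁻¹ (≤-trans j< (≤-reflexive (len≡ c)))) })
      , subst (λ i → get x i ≤ n) (sym (len≡ c)) upper
      , (λ { k (s≤s k<c) → subst₂ (λ i j → get x i < get x j) (sym (2k+1≡ k)) (sym (2k+3≡ k)) (strict k k<c) })
      where open Vertex V

  module _ (x y : Vec ℕ (len (suc c))) where

    EdgeDir⇒Edge : EdgeDir (suc c) x y → Edge c (entries x) (entries y)
    EdgeDir⇒Edge (lt , back , adv) = record
      { lt   = λ k k≤c → subst (λ i → get x i < get y i) (2k+1≡ k) (lt k (s≤s k≤c))
      ; back = λ k k<c → subst₂ (λ i j → get y i ≤ get x j) (2k+1≡ k) (2k+3≡ k) (back k (s≤s k<c))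
      ; adv  = λ j j< → adv (suc j) (s≤s z≤n) (≤-trans j< (≤-reflexive (cong pred (sym (len≡ c)))))
      }

    Edge⇒EdgeDir : Edge c (entries x) (entries y) → EdgeDir (suc c) x y
    Edge⇒EdgeDir E =
        (λ { k (s≤s k≤c) → subst (λ i → get x i < get y i) (sym (2k+1≡ k)) (lt k k≤c) })
      , (λ { k (s≤s k<c) → subst₂ (λ i j → get y i ≤ get x j) (sym (2k+1≡ k)) (sym (2k+3≡ k)) (back k k<c) })
      , (λ { (suc j) _ j< → adv j (≤-trans j< (≤-reflexive (cong pred (len≡ c)))) })
      where open Edge E

module _ {c : ℕ} {X Z : ℕ → ℕ} (X≗Z : ∀ {j} → j < suc (c * 2) → X j ≡ Z j) where

  private
    odd< : ∀ {k} → k ≤ c → k * 2 < suc (c * 2)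
    odd< k≤c = s≤s (*-monoˡ-≤ 2 k≤c)

  Vertex-resp : ∀ {n} → Vertex c n Z → Vertex c n X
  Vertex-resp V = record
    { lower  = subst (1 ≤_) (sym (X≗Z (s≤s z≤n))) lower
    ; weak   = λ j j< → subst₂ _≤_ (sym (X≗Z (m≤n⇒m≤1+n j<))) (sym (X≗Z (s≤s j<))) (weak j j<)
    ; upper  = subst (_≤ _) (sym (X≗Z ≤-refl)) upper
    ; strict = λ k k<c → subst₂ _<_ (sym (X≗Z (odd< (<⇒≤ k<c)))) (sym (X≗Z (odd< k<c))) (strict k k<c)
    }
    where open Vertex V

  Edge-resp : ∀ {Y W} → (∀ {j} → j < suc (c * 2) → Y j ≡ W j) → Edge c Z W → Edge c X Y
  Edge-resp Y≗W E = record
    { lt   = λ k k≤c → subst₂ _<_ (sym (X≗Z (odd< k≤c))) (sym (Y≗W (odd< k≤c))) (lt k k≤c)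
    ; back = λ k k<c → subst₂ _≤_ (sym (Y≗W (odd< (<⇒≤ k<c)))) (sym (X≗Z (odd< k<c))) (back k k<c)
    ; adv  = λ j j< → subst₂ _≤_ (sym (X≗Z (s≤s j<))) (sym (Y≗W (m≤n⇒m≤1+n j<))) (adv j j<)
    }
    where open Edge E

ChiLe⇒Colouring : ∀ {c n K} → ChiLe (suc c) n K → Colouring c n (Fin K)
ChiLe⇒Colouring {c} {n} {K} (f , proper) =
    (λ X VX → f (vertex X VX))
  , λ {X} {Y} VX VY E → proper (vertex X VX) (vertex Y VY)
      (inj₁ (Edge⇒EdgeDir (vec X) (vec Y) (Edge-resp (entries-tuple≡ X) (entries-tuple≡ Y) E)))
  where
  vec : (ℕ → ℕ) → Vec ℕ (len (suc c))
  vec = tuple (len (suc c))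
  entries-tuple≡ : ∀ X {j} → j < suc (c * 2) → entries (vec X) j ≡ X j
  entries-tuple≡ X j< = entries-tuple (len (suc c)) X (≤-trans j< (≤-reflexive (sym (len≡ c))))
  vertex : ∀ X → Vertex c n X → V (suc c) n
  vertex X VX = vec X , Vertex⇒IsVertex n (vec X) (Vertex-resp (entries-tuple≡ X) VX)

Colouring⇒ChiLe : ∀ {c n K} → Colouring c n (Fin K) → ChiLe (suc c) n K
Colouring⇒ChiLe {c} {n} (f , proper) =
    (λ (x , v) → f (entries x) (IsVertex⇒Vertex n x v))
  , λ { (x , v) (y , w) (inj₁ e) → proper _ _ (EdgeDir⇒Edge x y e)
      ; (x , v) (y , w) (inj₂ e) → proper _ _ (EdgeDir⇒Edge y x e) ∘ sym }

-- Counting colours and iterated logarithms.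

weaken : ∀ {c n K K′} → K ≤ K′ → Colouring c n (Fin K) → Colouring c n (Fin K′)
weaken K≤K′ = recolour (mk↣ {to = λ i → inject≤ i K≤K′} (inject≤-injective K≤K′ K≤K′ _ _))

palette-↣ : ∀ c K → Palette c (Fin K) ↣ Fin (2 ^ c * K + (2 ^ c * K + #patterns (suc (c * 2))))
palette-↣ c K = ↔⇒↣ (↔-trans
  (↔-sym *↔× ⊎-↔ ↔-trans (↔-sym *↔× ⊎-↔ ↔-refl) (↔-sym +↔⊎))
  (↔-sym +↔⊎))

module Step (n : ℕ) where

  L : ℕ
  L = suc ⌊log₂ n ⌋

  open Colourings {n} {L} (dyadic L) (level-≤ L)
    (dyadic-chain (n<2^[1+⌊log₂n⌋] n)) (dyadic-link (n<2^[1+⌊log₂n⌋] n))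

  -- The exponent `suc (c * 2)` is the difference of consecutive squares. It is the single bit of
  -- triples for `c = 0` and at least the `c + 2` bits of both monotone shapes afterwards.
  colouring-step : ∀ c {K} → Colouring c L (Fin K) →
    Colouring (suc c) n (Fin (2 ^ suc (c * 2) * K + #patterns (suc (suc c * 2))))
  colouring-step zero    C = weaken (m≤m+n _ _) (recolour (↔⇒↣ (↔-sym *↔×)) (colour-triples C))
  colouring-step (suc c) {K} C = weaken bound≤ (recolour (palette-↣ (2 + c) K) (colour-tuples C))
    where
    open ≤-Reasoning
    p = #patterns (suc ((2 + c) * 2))
    bound≤ : 2 ^ (2 + c) * K + (2 ^ (2 + c) * K + p) ≤ 2 ^ suc (suc c * 2) * K + p
    bound≤ = begin
      2 ^ (2 + c) * K + (2 ^ (2 + c) * K + p) ≡⟨ double (2 ^ (2 + c)) K p ⟩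
      2 ^ (3 + c) * K + p                     ≤⟨ +-monoˡ-≤ p (*-monoˡ-≤ K (^-monoʳ-≤ 2 (+-monoʳ-≤ 3 (m≤m*n c 2)))) ⟩
      2 ^ suc (suc c * 2) * K + p             ∎
      where
      double : ∀ q K p → q * K + (q * K + p) ≡ 2 * q * K + p
      double = solve 3 (λ q K p → q :* K :+ (q :* K :+ p) := con 2 :* q :* K :+ p) refl
        where open +-*-Solver

-- `logIter` adds its logarithms on the outside, the recursion on b on the inside.
logIter-log : ∀ t n → logIter t ⌊log₂ n ⌋ ≡ logIter (suc t) n
logIter-log zero    n = refl
logIter-log (suc t) n = cong ⌊log₂_⌋ (logIter-log t n)

-- Keeps the rounding in `suc ⌊log₂ n ⌋` an additive 1 through all further logarithms.
logIter-suc : ∀ t n → logIter t (suc n) ≤ suc (logIter t n)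
logIter-suc zero    n = ≤-refl
logIter-suc (suc t) n = ≤-trans (⌊log₂⌋-mono-≤ (logIter-suc t n)) (⌊log₂[1+n]⌋≤1+⌊log₂n⌋ (logIter t n))

logIter-unbounded : ∀ t K → ∃ λ N → ∀ n → N ≤ n → K ≤ logIter t n
logIter-unbounded zero    K = K , λ _ K≤n → K≤n
logIter-unbounded (suc t) K with logIter-unbounded t (2 ^ K)
... | N , large = N , λ n N≤n → ≤-trans (≤-reflexive (sym (⌊log₂[2^n]⌋≡n K))) (⌊log₂⌋-mono-≤ (large n N≤n))

colouring : ∀ c → ∃ λ D → ∀ n → Colouring c n (Fin (2 ^ (c * c) * logIter c n + D))
colouring zero = 0 , λ n → weaken (≤-reflexive (sym (trans (+-identityʳ _) (*-identityˡ n)))) (complete n)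
  where
  complete : ∀ n → Colouring 0 n (Fin n)
  complete n =
      -- Entries start at 1, so the predecessor is below `n`.
      (λ X V → fromℕ< {pred (X 0)} (pred< V))
    , λ {X} {Y} VX VY E eq → <-irrefl (pred-injective {{>-nonZero (lower VX)}} {{>-nonZero (lower VY)}} (fromℕ<-injective _ _ _ _ eq)) (Edge.lt E 0 z≤n)
    where
    open Vertex
    pred< : ∀ {X} → Vertex 0 n X → pred (X 0) < n
    pred< {X} V with X 0 | lower V | upper V
    ... | suc _ | _ | le = le
colouring (suc c) with colouring c
... | D , colour = D′ , λ n → weaken (bound≤ n) (Step.colouring-step n c (colour (suc ⌊log₂ n ⌋)))
  where
  open ≤-Reasoning
  q p D′ : ℕ
  q  = 2 ^ suc (c * 2)
  p  = #patterns (suc (suc c * 2))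
  -- The summands come from the extra 1 beside the logarithm, from the old constant, and from the
  -- extra colours of `colouring-step`.
  D′ = 2 ^ (suc c * suc c) + q * D + p

  square : q * 2 ^ (c * c) ≡ 2 ^ (suc c * suc c)
  square = trans (sym (^-distribˡ-+-* 2 (suc (c * 2)) (c * c)))
    (cong (2 ^_) (solve 1 (λ c → con 1 :+ c :* con 2 :+ c :* c := (con 1 :+ c) :* (con 1 :+ c)) refl c))
    where open +-*-Solver

  bound≤ : ∀ n → q * (2 ^ (c * c) * logIter c (suc ⌊log₂ n ⌋) + D) + p
               ≤ 2 ^ (suc c * suc c) * logIter (suc c) n + D′
  bound≤ n = begin
    q * (2 ^ (c * c) * logIter c (suc ⌊log₂ n ⌋) + D) + p
      ≤⟨ +-monoˡ-≤ p (*-monoʳ-≤ q (+-monoˡ-≤ D (*-monoʳ-≤ (2 ^ (c * c)) (logIter-suc c ⌊log₂ n ⌋)))) ⟩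
    q * (2 ^ (c * c) * suc (logIter c ⌊log₂ n ⌋) + D) + p
      ≡⟨ cong (λ ℓ → q * (2 ^ (c * c) * suc ℓ + D) + p) (logIter-log c n) ⟩
    q * (2 ^ (c * c) * suc ℓ + D) + p
      ≡⟨ solve 5 (λ q r ℓ D p → q :* (r :* (con 1 :+ ℓ) :+ D) :+ p
                              := (q :* r) :* ℓ :+ ((q :* r) :+ q :* D :+ p)) refl q (2 ^ (c * c)) ℓ D p ⟩
    q * 2 ^ (c * c) * ℓ + (q * 2 ^ (c * c) + q * D + p)
      ≡⟨ cong (λ r → r * ℓ + (r + q * D + p)) square ⟩
    2 ^ (suc c * suc c) * ℓ + D′ ∎
    where
    open +-*-Solver
    ℓ = logIter (suc c) n

theorem4p3 : ∀ (b : ℕ) → 1 ≤ b → ∀ (k : ℕ) →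
    ∃ λ (N : ℕ) → ∀ (n : ℕ) → N ≤ n → ChiLe b n (bound b k n)
theorem4p3 (suc c) _ k with colouring c
-- Once the logarithm reaches `D * suc k`, the term 1/(k+1) in `bound` absorbs `D`.
... | D , colour with logIter-unbounded c (D * suc k)
... | N , large = N , λ n N≤n → Colouring⇒ChiLe (weaken (bound≤ n (large n N≤n)) (colour n))
  where
  open ≤-Reasoning
  r : ℕ
  r = 2 ^ (c * c)
  bound≤ : ∀ n → D * suc k ≤ logIter c n → r * logIter c n + D ≤ bound (suc c) k n
  bound≤ n D≤ℓ = begin
    r * ℓ + D
      ≡⟨ m*n/n≡m (r * ℓ + D) (suc k) ⟨
    (r * ℓ + D) * suc k / suc k
      ≤⟨ /-monoˡ-≤ (suc k) (begin
        (r * ℓ + D) * suc k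
          ≡⟨ *-distribʳ-+ (suc k) (r * ℓ) D ⟩
        r * ℓ * suc k + D * suc k
          ≤⟨ +-monoʳ-≤ (r * ℓ * suc k) D≤ℓ ⟩
        r * ℓ * suc k + ℓ
          ≡⟨ solve 3 (λ r ℓ s → r :* ℓ :* s :+ ℓ := (s :* r :+ con 1) :* ℓ) refl r ℓ (suc k) ⟩
        (suc k * r + 1) * ℓ ∎) ⟩
    bound (suc c) k n ∎
    where
    open +-*-Solver
    ℓ = logIter c n
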